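{- For every integer $t\geq 1$, every graph that does not contain $K_t$ as an immersion is $2$-colourable with defect $(t-1)^3$.
   Context: All graphs are finite and simple. A graph $G$ contains $H$ as an immersion if the vertices of $H$ can be mapped to distinct vertices of $G$ and the edges of $H$ to pairwise edge-disjoint paths in $G$ such that each edge $vw$ of $H$ is mapped to a path whose endpoints are the images of $v$ and $w$. A graph is $k$-colourable with defect $d$ if its vertices can be given one of $k$ colours (not necessarily properly) so that each vertex has at most $d$ neighbours of its own colour. -}

module Defs where

open import Data.Nat using (ℕ; _≤_)
open import Data.Fin using (Fin; _<_; _≟_)
open import Data.List using (List; []; _∷_; head; last; filter; length)
open import Data.List.Relation.Unary.Linked using (Linked)
open import Data.List.Relation.Unary.Unique.Propositional using (Unique)
open import Data.Maybe using (just)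
open import Data.Product using (_×_; Σ)
open import Data.Empty using (⊥)
open import Relation.Nullary using (¬_; Dec)
open import Relation.Nullary.Decidable using (_×-dec_)
open import Relation.Binary.PropositionalEquality using (_≡_)
open import Data.List using (allFin)

record Graph : Set₁ where
  field
    n      : ℕ
    Adj    : Fin n → Fin n → Set
    adj?   : ∀ u v → Dec (Adj u v)
    sym    : ∀ {u v} → Adj u v → Adj v u
    irrefl : ∀ {u} → ¬ Adj u u

module _ (G : Graph) where
  open Graph G

  record Path (a b : Fin n) : Set where
    field
      verts  : List (Fin n)
      starts : head verts ≡ just a
      ends   : last verts ≡ just b
      walk   : Linked Adj verts
      simple : Unique verts

  data Consec (u v : Fin n) : List (Fin n) → Set where
    here  : ∀ {xs} → Consec u v (u ∷ v ∷ xs)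
    there : ∀ {x xs} → Consec u v xs → Consec u v (x ∷ xs)

  UsesEdge : ∀ {a b} → Path a b → Fin n → Fin n → Set
  UsesEdge P u v = Consec u v (Path.verts P) ⊎' Consec v u (Path.verts P)
    where
      open import Data.Sum renaming (_⊎_ to _⊎'_)

  record KImmersion (t : ℕ) : Set where
    field
      φ        : Fin t → Fin n
      φ-inj    : ∀ i j → φ i ≡ φ j → i ≡ j
      path     : ∀ (i j : Fin t) → i < j → Path (φ i) (φ j)
      disjoint : ∀ i j i′ j′ (p : i < j) (p′ : i′ < j′) →
                 ¬ (i ≡ i′ × j ≡ j′) →
                 ∀ u v → UsesEdge (path i j p) u v →
                 ¬ UsesEdge (path i′ j′ p′) u v

  ContainsKImmersion : ℕ → Set
  ContainsKImmersion t = KImmersion t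

  sameColourDegree : ∀ {k} → (Fin n → Fin k) → Fin n → ℕ
  sameColourDegree c v =
    length (filter (λ w → adj? v w ×-dec (c w ≟ c v)) (allFin n))

  ColourableWithDefect : ℕ → ℕ → Set
  ColourableWithDefect k d =
    Σ (Fin n → Fin k) λ c → ∀ v → sameColourDegree c v ≤ d

{-# OPTIONS --safe #-}

-- Write t = s + 1 and let δ(X) be the number of edges leaving X. If s + 1 vertices are pairwise not
-- separated by a cut with δ < s², then s edge-disjoint paths from each of s of them to the last one
-- exist simultaneously (Menger), and joining the b-th path of a to the a-th path of b gives an immersion of K_t.
-- Otherwise uncrossing minimum cuts yields a laminar family of sets with δ < s² such that at most s vertices
-- lie in any bag of the associated rooted tree. Going down the tree, give each bag the colour opposite to that
-- of the topmost proper ancestor bag adjacent to it. A neighbour w of v of the same colour outside the bag of v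
-- is then either outside the subtree of v or in a bag with an edge leaving this subtree, and every
-- edge leaving the subtree accounts for at most s such w: at most s + (s² − 1) s = s³ in all.
--
-- Menger's theorem is proved by moving tokens: the cut condition says that every set avoiding the
-- sink has at least as many leaving arcs as tokens. As tight sets are closed under union, some out-arc of any
-- token off the sink can be deleted, moving the token along it, without violating the condition.
-- To keep the paths disjoint as sets of undirected edges, the graph is oriented beforehand.

module Submission where

open import Defs
open import Algebra.Properties.Semiring.Sum as Sum using ()
open import Data.Bool using (Bool; true; false; not; _∧_; _∨_; if_then_else_)
open import Data.Bool.Properties using (not-injective; ¬-not; ∧-conicalˡ; ∧-conicalʳ; ∧-zeroʳ; ∧-identityʳ; ∨-zeroʳ; ⇔→≡) renaming (_≟_ to _≟ᵇ_)
open import Data.Empty using (⊥-elim)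
open import Data.Fin using (Fin; zero; suc; _≟_; combine; remQuot; opposite)
import Data.Fin as Fin
open import Data.Fin.Properties using (any?; all?; suc-injective; remQuot-combine)
import Data.Fin.Properties as Fin
open import Data.Fin.Subset.Properties using (anySubset?)
open import Data.List using (List; []; _∷_; head; last; filter; length; allFin; cartesianProduct; tabulate)
open import Data.List.Membership.Propositional using (_∈_)
open import Data.List.Membership.Propositional.Properties using (∈-cartesianProduct⁺; ∈-allFin)
open import Data.List.Relation.Unary.All as All using (All; []; _∷_)
open import Data.List.Relation.Unary.All.Properties using (¬Any⇒All¬)
open import Data.List.Relation.Unary.AllPairs using (AllPairs; []; _∷_)
open import Data.List.Relation.Unary.Any using (here; there)
import Data.List.Relation.Unary.Any as Any
open import Data.List.Relation.Unary.Linked using (Linked; []; [-]; _∷_)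
import Data.List.Relation.Unary.Linked as Linked
open import Data.List.Relation.Unary.Unique.Propositional using (Unique)
open import Data.Maybe using (Maybe; just; nothing)
open import Data.Nat using (ℕ; zero; suc; _+_; _*_; _≤_; _<_; _∸_; _^_; z≤n; s≤s; _<?_)
open import Data.Nat.Properties hiding (_≟_; suc-injective)
open import Data.Product using (∃; ∃₂; _×_; _,_; proj₁; proj₂)
open import Data.Sum using (_⊎_; inj₁; inj₂; [_,_]; swap)
open import Data.Vec using (lookup) renaming (tabulate to vtabulate)
open import Data.Vec.Properties using (lookup∘tabulate)
open import Data.Vec.Functional using (updateAt)
open import Data.Vec.Functional.Properties using (updateAt-updates; updateAt-minimal)
open import Function using (_∘_; id; case_of_; mk⇔)
open import Relation.Binary.Construct.Closure.ReflexiveTransitive as Star using (Star; ε; _◅_; _◅◅_)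
open import Relation.Binary.PropositionalEquality using (_≡_; _≢_; _≗_; refl; sym; trans; cong; cong₂; subst; subst₂)
open import Relation.Nullary using (¬_; Dec; yes; no; does)
open import Relation.Nullary.Decidable using (map′; _×-dec_; _⊎-dec_; _→-dec_; ¬?; dec-true; dec-false)

open Sum +-*-semiring using (sum; sum-cong-≗; ∑-distrib-+; ∑-comm; sum-replicate-zero; *-distribʳ-sum)

private
  variable
    m n : ℕ

-- Finite sums

𝟙 : Bool → ℕ
𝟙 b = if b then 1 else 0

𝟙-mono : ∀ {b c} → (b ≡ true → c ≡ true) → 𝟙 b ≤ 𝟙 c
𝟙-mono {false}        _ = z≤n
𝟙-mono {true} {true}  _ = ≤-refl
𝟙-mono {true} {false} h with () ← h refl

sum-mono : {f g : Fin n → ℕ} → (∀ i → f i ≤ g i) → sum f ≤ sum g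
sum-mono {zero}  _ = z≤n
sum-mono {suc n} h = +-mono-≤ (h zero) (sum-mono (h ∘ suc))

sum-mono-< : {f g : Fin n → ℕ} → (∀ i → f i ≤ g i) → ∀ i → f i < g i → sum f < sum g
sum-mono-< h zero    lt = +-mono-<-≤ lt (sum-mono (h ∘ suc))
sum-mono-< h (suc i) lt = +-mono-≤-< (h zero) (sum-mono-< (h ∘ suc) i lt)

≤-sum : (f : Fin n → ℕ) → ∀ i → f i ≤ sum f
≤-sum f zero    = m≤m+n _ _
≤-sum f (suc i) = ≤-trans (≤-sum (f ∘ suc) i) (m≤n+m _ _)

-- One-point changes, written without subtraction: deleting an arc and moving a token are both
-- handled through it.
sum-update : (f g : Fin n → ℕ) → ∀ i → (∀ j → j ≢ i → f j ≡ g j) → sum f + g i ≡ sum g + f i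
sum-update f g zero h
  rewrite sum-cong-≗ {x = f ∘ suc} {y = g ∘ suc} (λ j → h (suc j) λ ()) = begin-equality
    f zero + S + g zero   ≡⟨ cong (_+ g zero) (+-comm (f zero) S) ⟩
    S + f zero + g zero   ≡⟨ +-comm (S + f zero) (g zero) ⟩
    g zero + (S + f zero) ≡⟨ +-assoc (g zero) S (f zero) ⟨
    g zero + S + f zero   ∎
  where
  open ≤-Reasoning
  S = sum (g ∘ suc)
sum-update f g (suc i) h
  rewrite h zero (λ ())
        | +-assoc (g zero) (sum (f ∘ suc)) (g (suc i))
        | +-assoc (g zero) (sum (g ∘ suc)) (f (suc i)) =
  cong (g zero +_) (sum-update (f ∘ suc) (g ∘ suc) i λ j ne → h (suc j) (ne ∘ suc-injective))

Σ² : (Fin n → Fin n → ℕ) → ℕ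
Σ² f = sum λ p → sum (f p)

Σ²-cong : {f g : Fin n → Fin n → ℕ} → (∀ p q → f p q ≡ g p q) → Σ² f ≡ Σ² g
Σ²-cong h = sum-cong-≗ λ p → sum-cong-≗ (h p)

Σ²-mono : {f g : Fin n → Fin n → ℕ} → (∀ p q → f p q ≤ g p q) → Σ² f ≤ Σ² g
Σ²-mono h = sum-mono λ p → sum-mono (h p)

Σ²-distrib-+ : (f g : Fin n → Fin n → ℕ) → Σ² (λ p q → f p q + g p q) ≡ Σ² f + Σ² g
Σ²-distrib-+ f g = trans (sum-cong-≗ λ p → ∑-distrib-+ (f p) (g p)) (∑-distrib-+ (sum ∘ f) (sum ∘ g))

≤-Σ² : (f : Fin n → Fin n → ℕ) → ∀ p q → f p q ≤ Σ² f
≤-Σ² f p q = ≤-trans (≤-sum (f p) q) (≤-sum (sum ∘ f) p)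

Σ²-update : (f g : Fin n → Fin n → ℕ) → ∀ x y → (∀ p q → ¬ (p ≡ x × q ≡ y) → f p q ≡ g p q) →
            Σ² f + g x y ≡ Σ² g + f x y
Σ²-update f g x y h = +-cancelʳ-≡ (sum (g x)) _ _ (begin-equality
  Σ² f + g x y + sum (g x)   ≡⟨ right-comm (Σ² f) (g x y) (sum (g x)) ⟩
  Σ² f + sum (g x) + g x y   ≡⟨ cong (_+ g x y) (sum-update (sum ∘ f) (sum ∘ g) x λ p ne → sum-cong-≗ λ q → h p q (ne ∘ proj₁)) ⟩
  Σ² g + sum (f x) + g x y   ≡⟨ +-assoc (Σ² g) _ _ ⟩
  Σ² g + (sum (f x) + g x y) ≡⟨ cong (Σ² g +_) (sum-update (f x) (g x) y λ q ne → h x q (ne ∘ proj₂)) ⟩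
  Σ² g + (sum (g x) + f x y) ≡⟨ cong (Σ² g +_) (+-comm (sum (g x)) _) ⟩
  Σ² g + (f x y + sum (g x)) ≡⟨ +-assoc (Σ² g) _ _ ⟨
  Σ² g + f x y + sum (g x)   ∎)
  where
  open ≤-Reasoning
  right-comm : ∀ a b c → a + b + c ≡ a + c + b
  right-comm a b c = trans (+-assoc a b c) (trans (cong (a +_) (+-comm b c)) (sym (+-assoc a c b)))

sum-zero : {f : Fin n → ℕ} → (∀ i → f i ≡ 0) → sum f ≡ 0
sum-zero {n} h = trans (sum-cong-≗ h) (sum-replicate-zero n)

count-injection : ∀ s (P : Fin n → Bool) → s ≤ sum (𝟙 ∘ P) →
                  ∃ λ (φ : Fin s → Fin n) → (∀ i j → φ i ≡ φ j → i ≡ j) × (∀ i → P (φ i) ≡ true)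
count-injection zero P _ = (λ ()) , (λ ()) , λ ()
count-injection {suc n} (suc s) P le with P zero in eq
... | false with φ , inj , Pφ ← count-injection (suc s) (P ∘ suc) le =
  suc ∘ φ , (λ i j → inj i j ∘ suc-injective) , Pφ
... | true with φ , inj , Pφ ← count-injection s (P ∘ suc) (≤-pred le) =
  φ⁺ , inj⁺ , λ { zero → eq ; (suc i) → Pφ i }
  where
  φ⁺ : Fin (suc s) → Fin (suc n)
  φ⁺ zero    = zero
  φ⁺ (suc i) = suc (φ i)
  inj⁺ : ∀ i j → φ⁺ i ≡ φ⁺ j → i ≡ j
  inj⁺ zero    zero    _ = refl
  inj⁺ (suc i) (suc j) e = cong suc (inj i j (suc-injective e))

length-filter-tabulate : ∀ {A : Set} {P : A → Set} (P? : ∀ x → Dec (P x)) (f : Fin n → A) →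
                         length (filter P? (tabulate f)) ≡ sum λ i → 𝟙 (does (P? (f i)))
length-filter-tabulate {zero}  P? f = refl
length-filter-tabulate {suc n} P? f with does (P? (f zero))
... | true  = cong suc (length-filter-tabulate P? (f ∘ suc))
... | false = length-filter-tabulate P? (f ∘ suc)

-- Edge cuts

Subset : ℕ → Set
Subset n = Fin n → Bool

Digraph : ℕ → Set
Digraph n = Fin n → Fin n → Bool

infixl 7 _∩_ _∖_
infixl 6 _∪_

_∩_ _∪_ _∖_ : Subset n → Subset n → Subset n
(W ∩ Z) x = W x ∧ Z x
(W ∪ Z) x = W x ∨ Z x
(W ∖ Z) x = W x ∧ not (Z x)

∁ : Subset n → Subset n
∁ W x = not (W x)

-- The search runs over bit vectors; `P` must respect `≗` because a subset agrees only pointwise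
-- with its tabulated copy.
anySet? : {P : Subset n → Set} → (∀ W → Dec (P W)) → (∀ {W Z} → W ≗ Z → P W → P Z) → Dec (∃ P)
anySet? P? resp = map′
  (λ (V , p) → lookup V , p)
  (λ (W , p) → vtabulate W , resp (sym ∘ lookup∘tabulate W) p)
  (anySubset? (P? ∘ lookup))

leaves : Digraph n → Subset n → Fin n → Fin n → Bool
leaves D W p q = D p q ∧ W p ∧ not (W q)

χ : Digraph n → Subset n → Fin n → Fin n → ℕ
χ D W p q = 𝟙 (leaves D W p q)

δ : Digraph n → Subset n → ℕ
δ D W = Σ² (χ D W)

δ-cong : (D : Digraph n) {W Z : Subset n} → W ≗ Z → δ D W ≡ δ D Z
δ-cong D h = Σ²-cong λ p q → cong₂ (λ a b → 𝟙 (D p q ∧ a ∧ not b)) (h p) (h q)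

-- The share of one arc: `d` is its presence, `a` and `c` the membership of its tail in the two
-- sets, `b` and `e` that of its head. Only arcs between the two differences make it strict.
𝟙-submodular : ∀ d a b c e →
  𝟙 (d ∧ (a ∧ c) ∧ not (b ∧ e)) + 𝟙 (d ∧ (a ∨ c) ∧ not (b ∨ e)) ≤ 𝟙 (d ∧ a ∧ not b) + 𝟙 (d ∧ c ∧ not e)
𝟙-submodular false _     _     _     _     = z≤n
𝟙-submodular true  false _     false _     = z≤n
𝟙-submodular true  false true  true  _     = z≤n
𝟙-submodular true  false false true  _     = ≤-refl
𝟙-submodular true  true  true  false _     = z≤n
𝟙-submodular true  true  false false true  = z≤n
𝟙-submodular true  true  false false false = ≤-refl
𝟙-submodular true  true  true  true  true  = z≤n
𝟙-submodular true  true  true  true  false = ≤-refl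
𝟙-submodular true  true  false true  true  = ≤-refl
𝟙-submodular true  true  false true  false = ≤-refl

δ-submodular : (D : Digraph n) (W Z : Subset n) → δ D (W ∩ Z) + δ D (W ∪ Z) ≤ δ D W + δ D Z
δ-submodular D W Z = subst₂ _≤_
  (Σ²-distrib-+ (χ D (W ∩ Z)) (χ D (W ∪ Z)))
  (Σ²-distrib-+ (χ D W) (χ D Z))
  (Σ²-mono λ p q → 𝟙-submodular (D p q) (W p) (W q) (Z p) (Z q))

Symmetric : Digraph n → Set
Symmetric D = ∀ p q → D p q ≡ D q p

δ-∁ : (D : Digraph n) → Symmetric D → ∀ W → δ D (∁ W) ≡ δ D W
δ-∁ D D-sym W = trans (Σ²-cong pointwise) (∑-comm λ p q → χ D W q p)
  where
  pointwise : ∀ p q → χ D (∁ W) p q ≡ χ D W q p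
  pointwise p q rewrite D-sym p q with D q p | W p | W q
  ... | false | _     | _     = refl
  ... | true  | true  | true  = refl
  ... | true  | true  | false = refl
  ... | true  | false | true  = refl
  ... | true  | false | false = refl

-- Submodularity for `W` and `∁ Z`: the complement of their union is `Z ∖ W`, and complements have
-- equal `δ` by symmetry.
δ-posimodular : (D : Digraph n) → Symmetric D → ∀ W Z → δ D (W ∖ Z) + δ D (Z ∖ W) ≤ δ D W + δ D Z
δ-posimodular D D-sym W Z = subst₂ _≤_
  (cong (δ D (W ∖ Z) +_) (trans (sym (δ-∁ D D-sym (W ∪ ∁ Z))) (δ-cong D pointwise)))
  (cong (δ D W +_) (δ-∁ D D-sym Z))
  (δ-submodular D W (∁ Z))
  where
  pointwise : ∁ (W ∪ ∁ Z) ≗ (Z ∖ W)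
  pointwise x with W x | Z x
  ... | true  | true  = refl
  ... | true  | false = refl
  ... | false | true  = refl
  ... | false | false = refl

remove : Digraph n → Fin n → Fin n → Digraph n
remove D x y p q = D p q ∧ not (does (p ≟ x) ∧ does (q ≟ y))

remove-self : (D : Digraph n) → ∀ x y → remove D x y x y ≡ false
remove-self D x y rewrite dec-true (x ≟ x) refl | dec-true (y ≟ y) refl = ∧-zeroʳ (D x y)

remove-other : (D : Digraph n) → ∀ {x y p q} → ¬ (p ≡ x × q ≡ y) → remove D x y p q ≡ D p q
remove-other D {x} {y} {p} {q} ne with p ≟ x | q ≟ y
... | yes e | yes e′ = ⊥-elim (ne (e , e′))
... | yes _ | no _   = ∧-identityʳ _
... | no _  | _      = ∧-identityʳ _

δ-remove : (D : Digraph n) → ∀ {x y} → D x y ≡ true → ∀ W →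
           δ D W ≡ δ (remove D x y) W + 𝟙 (W x ∧ not (W y))
δ-remove D {x} {y} Dxy W = trans (sym (+-identityʳ _)) (subst₂ (λ a b → δ D W + a ≡ δ (remove D x y) W + b)
  (cong (λ d → 𝟙 (d ∧ W x ∧ not (W y))) (remove-self D x y))
  (cong (λ d → 𝟙 (d ∧ W x ∧ not (W y))) Dxy)
  (Σ²-update (χ D W) (χ (remove D x y) W) x y
    λ p q ne → cong (λ d → 𝟙 (d ∧ W p ∧ not (W q))) (sym (remove-other D ne))))

size : Digraph n → ℕ
size D = Σ² λ p q → 𝟙 (D p q)

size-remove : (D : Digraph n) → ∀ {x y} → D x y ≡ true → size D ≡ size (remove D x y) + 1
size-remove D {x} {y} Dxy = trans (sym (+-identityʳ _)) (subst₂ (λ a b → size D + a ≡ size (remove D x y) + b)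
  (cong 𝟙 (remove-self D x y)) (cong 𝟙 Dxy)
  (Σ²-update (λ p q → 𝟙 (D p q)) (λ p q → 𝟙 (remove D x y p q)) x y
    λ p q ne → cong 𝟙 (sym (remove-other D ne))))

-- Routing tokens to a sink

load : (Fin m → Fin n) → Subset n → ℕ
load pos W = sum λ k → 𝟙 (W (pos k))

load-modular : (pos : Fin m → Fin n) → ∀ W Z → load pos (W ∩ Z) + load pos (W ∪ Z) ≡ load pos W + load pos Z
load-modular pos W Z = trans
  (sym (∑-distrib-+ (λ k → 𝟙 ((W ∩ Z) (pos k))) (λ k → 𝟙 ((W ∪ Z) (pos k)))))
  (trans (sum-cong-≗ λ k → pointwise (W (pos k)) (Z (pos k)))
         (∑-distrib-+ (λ k → 𝟙 (W (pos k))) (λ k → 𝟙 (Z (pos k)))))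
  where
  pointwise : ∀ a b → 𝟙 (a ∧ b) + 𝟙 (a ∨ b) ≡ 𝟙 a + 𝟙 b
  pointwise true  true  = refl
  pointwise true  false = refl
  pointwise false _     = refl

load-move : (pos : Fin m → Fin n) → ∀ k y W →
            load pos W + 𝟙 (W y) ≡ load (updateAt pos k λ _ → y) W + 𝟙 (W (pos k))
load-move pos k y W = subst (λ v → load pos W + 𝟙 (W v) ≡ load pos′ W + 𝟙 (W (pos k)))
  (updateAt-updates k pos)
  (sum-update (λ j → 𝟙 (W (pos j))) (λ j → 𝟙 (W (pos′ j))) k
    λ j ne → cong (𝟙 ∘ W) (sym (updateAt-minimal j k pos ne)))
  where
  pos′ = updateAt pos k λ _ → y

module Routing {n} (r : Fin n) where

  Routable : Digraph n → (Fin m → Fin n) → Set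
  Routable D pos = ∀ W → W r ≡ false → load pos W ≤ δ D W

  Violates : Digraph n → (Fin m → Fin n) → Subset n → Set
  Violates D pos W = W r ≡ false × δ D W < load pos W

  routable? : (D : Digraph n) (pos : Fin m → Fin n) → Routable D pos ⊎ ∃ (Violates D pos)
  routable? D pos with anySet? (λ W → (W r ≟ᵇ false) ×-dec (δ D W <? load pos W))
                               (λ h (a , b) → trans (sym (h r)) a ,
                                 subst₂ _<_ (δ-cong D h) (sum-cong-≗ λ k → cong 𝟙 (h (pos k))) b)
  ... | yes v = inj₂ v
  ... | no ¬v = inj₁ λ W Wr → ≮⇒≥ λ lt → ¬v (W , Wr , lt)

  -- Deleting the arc lowers `δ` only for sets that it leaves; any other violated set would already
  -- be violated in `D`.
  violation-uses : ∀ {D} {pos : Fin m → Fin n} {x y W} → Routable D pos → D x y ≡ true →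
                   Violates (remove D x y) pos W → W x ≡ true × W y ≡ false
  violation-uses {D = D} {x = x} {y} {W} ok Dxy (Wr , lt) with W x | W y | δ-remove D Dxy W
  ... | true  | false | _ = refl , refl
  ... | true  | true  | e = ⊥-elim (<⇒≱ lt (subst (_ ≤_) (trans e (+-identityʳ _)) (ok W Wr)))
  ... | false | _     | e = ⊥-elim (<⇒≱ lt (subst (_ ≤_) (trans e (+-identityʳ _)) (ok W Wr)))

  drop-one : ∀ {D} {pos : Fin m → Fin n} {x y} → x ≢ y → D x y ≡ true → D y x ≡ true → Routable D pos →
             Routable (remove D x y) pos ⊎ Routable (remove D y x) pos
  drop-one {D = D} {pos} {x} {y} x≢y Dxy Dyx ok with routable? (remove D x y) pos | routable? (remove D y x) pos
  ... | inj₁ ok′ | _ = inj₁ ok′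
  ... | inj₂ _   | inj₁ ok′ = inj₂ ok′
  ... | inj₂ (W , v@(Wr , ltW)) | inj₂ (Z , v′@(Zr , ltZ)) = ⊥-elim (<-irrefl refl (begin-strict
    load pos W + load pos Z                         ≡⟨ load-modular pos W Z ⟨
    load pos (W ∩ Z) + load pos (W ∪ Z)             ≤⟨ +-mono-≤ (ok (W ∩ Z) (cong (_∧ Z r) Wr)) (ok (W ∪ Z) (cong₂ _∨_ Wr Zr)) ⟩
    δ D (W ∩ Z) + δ D (W ∪ Z)                       ≡⟨ Σ²-distrib-+ (χ D (W ∩ Z)) (χ D (W ∪ Z)) ⟨
    Σ² (λ p q → χ D (W ∩ Z) p q + χ D (W ∪ Z) p q)  ≤⟨ Σ²-mono pointwise ⟩
    Σ² (λ p q → χ Dˣ W p q + χ Dʸ Z p q)            ≡⟨ Σ²-distrib-+ (χ Dˣ W) (χ Dʸ Z) ⟩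
    δ Dˣ W + δ Dʸ Z                                 <⟨ +-mono-< ltW ltZ ⟩
    load pos W + load pos Z                         ∎))
    where
    open ≤-Reasoning
    Dˣ = remove D x y
    Dʸ = remove D y x
    Wxy = violation-uses {D = D} {pos} {x} {y} {W} ok Dxy v
    Zyx = violation-uses {D = D} {pos} {y} {x} {Z} ok Dyx v′
    Wx = proj₁ Wxy
    Wy = proj₂ Wxy
    Zx = proj₂ Zyx
    Zy = proj₁ Zyx
    wx : W x ∧ Z x ≡ false
    wx = trans (cong (W x ∧_) Zx) (∧-zeroʳ (W x))
    wy : W y ∧ Z y ≡ false
    wy = cong (_∧ Z y) Wy
    uncut : ∀ p q → W p ∧ Z p ≡ false → W q ∨ Z q ≡ true →
            χ D (W ∩ Z) p q + χ D (W ∪ Z) p q ≡ 0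
    uncut p q a b rewrite a | b | ∧-zeroʳ (W p ∨ Z p) | ∧-zeroʳ (D p q) = refl
    -- A set violating the condition without xy and one violating it without yx cross at x and y,
    -- so neither arc leaves their union or intersection.
    pointwise : ∀ p q → χ D (W ∩ Z) p q + χ D (W ∪ Z) p q ≤ χ Dˣ W p q + χ Dʸ Z p q
    pointwise p q with (p ≟ x) ×-dec (q ≟ y) | (p ≟ y) ×-dec (q ≟ x)
    ... | no ne | no ne′ rewrite remove-other D ne | remove-other D ne′ =
      𝟙-submodular (D p q) (W p) (W q) (Z p) (Z q)
    ... | yes (refl , refl) | _ = ≤-trans (≤-reflexive (uncut x y wx (cong₂ _∨_ Wy Zy))) z≤n
    ... | no _ | yes (refl , refl) = ≤-trans (≤-reflexive (uncut y x wy (cong₂ _∨_ Wx Zx))) z≤n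

  _⊑_ : Digraph n → Digraph n → Set
  D′ ⊑ D = ∀ {p q} → D′ p q ≡ true → D p q ≡ true

  Oriented : Digraph n → Fin n × Fin n → Set
  Oriented D (x , y) = ¬ (D x y ≡ true × D y x ≡ true)

  -- Pairs are treated one after another, and settled pairs stay settled because arcs are only ever
  -- deleted. Loops are excluded since a loop is its own reverse.
  orient : ∀ ps {D} {pos : Fin m → Fin n} → (∀ x → D x x ≡ false) → Routable D pos →
           ∃ λ D′ → D′ ⊑ D × Routable D′ pos × All (Oriented D′) ps
  orient [] _ ok = _ , id , ok , []
  orient ((x , y) ∷ ps) {D} {pos} loopless ok with orient ps {D} {pos} loopless ok
  ... | D′ , D′⊑D , ok′ , oriented with (D′ x y ≟ᵇ true) ×-dec (D′ y x ≟ᵇ true)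
  ... | no ¬both = D′ , D′⊑D , ok′ , ¬both ∷ oriented
  ... | yes (xy , yx) with drop-one {D = D′} {pos} x≢y xy yx ok′
    where
    x≢y : x ≢ y
    x≢y refl with () ← trans (sym (D′⊑D xy)) (loopless x)
  ... | inj₁ ok″ = remove D′ x y , D′⊑D ∘ ∧-conicalˡ _ _ , ok″ ,
    (λ (a , _) → case trans (sym a) (remove-self D′ x y) of λ ()) ∷
    All.map (λ h (a , b) → h (∧-conicalˡ _ _ a , ∧-conicalˡ _ _ b)) oriented
  ... | inj₂ ok″ = remove D′ y x , D′⊑D ∘ ∧-conicalˡ _ _ , ok″ ,
    (λ (_ , a) → case trans (sym a) (remove-self D′ y x) of λ ()) ∷
    All.map (λ h (a , b) → h (∧-conicalˡ _ _ a , ∧-conicalˡ _ _ b)) oriented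

  -- Under `Routable` the last inequality is an equality, so one more token entering `W` would break
  -- the cut condition.
  Tight : Digraph n → (Fin m → Fin n) → Fin n → Subset n → Set
  Tight D pos x W = W r ≡ false × W x ≡ false × δ D W ≤ load pos W

  -- The move lowers `δ` and the load together for sets that the arc leaves, raises the load by one
  -- for sets that it enters, and affects no others. A violated set is therefore entered by the arc
  -- and was tight before.
  push-or-tight : ∀ {D} {pos : Fin m → Fin n} k y → Routable D pos → D (pos k) y ≡ true →
                  Routable (remove D (pos k) y) (updateAt pos k λ _ → y) ⊎
                  ∃ λ W → Tight D pos (pos k) W × W y ≡ true
  push-or-tight {D = D} {pos} k y ok Dxy with routable? (remove D (pos k) y) (updateAt pos k λ _ → y)
  ... | inj₁ ok′ = inj₁ ok′
  ... | inj₂ (W , Wr , lt) with W (pos k) in Wx | W y in Wy | δ-remove D Dxy W | load-move pos k y W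
  ... | true  | true  | δ≡ | load≡ = ⊥-elim (<⇒≱ lt
        (subst₂ _≤_ (+-cancelʳ-≡ 1 _ _ load≡) (trans δ≡ (+-identityʳ _)) (ok W Wr)))
  ... | true  | false | δ≡ | load≡ = ⊥-elim (<⇒≱ lt
        (+-cancelʳ-≤ 1 _ _ (subst₂ _≤_ (trans (sym (+-identityʳ _)) load≡) δ≡ (ok W Wr))))
  ... | false | false | δ≡ | load≡ = ⊥-elim (<⇒≱ lt
        (subst₂ _≤_ (+-cancelʳ-≡ 0 _ _ load≡) (trans δ≡ (+-identityʳ _)) (ok W Wr)))
  ... | false | true  | δ≡ | load≡ = inj₂ (W , (Wr , Wx , ≤-pred (subst₂ _<_
        (trans (sym (+-identityʳ _)) (sym δ≡))
        (trans (sym (+-identityʳ _)) (trans (sym load≡) (+-comm _ 1))) lt)) , Wy)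

  -- `δ` is submodular and the load modular, so slack in the union would force a violation at the
  -- intersection.
  tight-∪ : ∀ {D} {pos : Fin m → Fin n} {x W Z} → Routable D pos →
            Tight D pos x W → Tight D pos x Z → Tight D pos x (W ∪ Z)
  tight-∪ {D = D} {pos} {W = W} {Z} ok (Wr , Wx , W≤) (Zr , Zx , Z≤) =
    cong₂ _∨_ Wr Zr , cong₂ _∨_ Wx Zx , +-cancelˡ-≤ (δ D (W ∩ Z)) _ _ (begin
      δ D (W ∩ Z) + δ D (W ∪ Z)           ≤⟨ δ-submodular D W Z ⟩
      δ D W + δ D Z                       ≤⟨ +-mono-≤ W≤ Z≤ ⟩
      load pos W + load pos Z             ≡⟨ load-modular pos W Z ⟨
      load pos (W ∩ Z) + load pos (W ∪ Z) ≤⟨ +-monoˡ-≤ _ (ok (W ∩ Z) (cong (_∧ Z r) Wr)) ⟩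
      δ D (W ∩ Z) + load pos (W ∪ Z)      ∎)
    where open ≤-Reasoning

  push-or-tight-all : ∀ {D} {pos : Fin m → Fin n} k → Routable D pos → ∀ ys →
    (∃ λ y → D (pos k) y ≡ true × Routable (remove D (pos k) y) (updateAt pos k λ _ → y)) ⊎
    (∃ λ W → Tight D pos (pos k) W × All (λ y → D (pos k) y ≡ true → W y ≡ true) ys)
  -- The empty set is tight and starts the union of the sets blocking the arcs.
  push-or-tight-all {D = D} k ok [] =
    inj₂ ((λ _ → false) , (refl , refl , ≤-trans (≤-reflexive δ-∅) z≤n) , [])
    where
    δ-∅ : δ D (λ _ → false) ≡ 0
    δ-∅ = sum-zero λ p → sum-zero λ q → cong 𝟙 (∧-zeroʳ (D p q))
  push-or-tight-all {D = D} {pos} k ok (y ∷ ys) with push-or-tight-all {D = D} {pos} k ok ys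
  ... | inj₁ push = inj₁ push
  ... | inj₂ (W , tight , all) with D (pos k) y in Dxy
  ... | false = inj₂ (W , tight , (λ e → case trans (sym Dxy) e of λ ()) ∷ all)
  ... | true with push-or-tight {D = D} {pos} k y ok Dxy
  ... | inj₁ ok′ = inj₁ (y , Dxy , ok′)
  ... | inj₂ (Z , tight′ , Zy) = inj₂ (Z ∪ W , tight-∪ {D = D} {pos} {pos k} {Z} {W} ok tight′ tight ,
    (λ _ → cong (_∨ W y) Zy) ∷ All.map (λ {v} h Dv → trans (cong (Z v ∨_) (h Dv)) (∨-zeroʳ (Z v))) all)

  -- A tight set containing all out-neighbours of x but not x violates the cut condition once x is added to it.
  push : ∀ {D} {pos : Fin m → Fin n} k → pos k ≢ r → Routable D pos →
         ∃ λ y → D (pos k) y ≡ true × Routable (remove D (pos k) y) (updateAt pos k λ _ → y)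
  push {D = D} {pos} k x≢r ok with push-or-tight-all {D = D} {pos} k ok (allFin n)
  ... | inj₁ p = p
  ... | inj₂ (W , (Wr , Wx , W≤) , all) = ⊥-elim (<-irrefl refl (begin-strict
    load pos W  <⟨ sum-mono-< (λ j → 𝟙-mono λ h → cong (_∨ does (pos j ≟ x)) h) k
                     (subst₂ (λ a b → 𝟙 a < 𝟙 b) (sym Wx) (sym W⁺x) ≤-refl) ⟩
    load pos W⁺ ≤⟨ ok W⁺ (cong₂ _∨_ Wr (dec-false (r ≟ x) (x≢r ∘ sym))) ⟩
    δ D W⁺      ≤⟨ Σ²-mono (λ p q → 𝟙-mono (pointwise p q)) ⟩
    δ D W       ≤⟨ W≤ ⟩
    load pos W  ∎))
    where
    open ≤-Reasoning
    x = pos k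
    W⁺ : Subset n
    W⁺ v = W v ∨ does (v ≟ x)
    W⁺x : W⁺ x ≡ true
    W⁺x = trans (cong (W x ∨_) (dec-true (x ≟ x) refl)) (∨-zeroʳ (W x))
    pointwise : ∀ p q → leaves D W⁺ p q ≡ true → leaves D W p q ≡ true
    pointwise p q h with D p q in Dpq | W p | W q in Wq | p ≟ x
    ... | true | true  | false | _ = refl
    -- An arc starting at `x` has its head in `W`, so adding `x` creates no new leaving arc.
    ... | true | false | false | yes refl with () ← trans (sym Wq) (All.lookup all (∈-allFin q) Dpq)
    ... | true | false | true  | yes refl = h
    ... | true | false | _     | no _ = h
    ... | true | true  | true  | _ = h
    ... | false | _    | _     | _ = h

  -- An arc has at most one owner, so arc-disjointness of the walks is built into the type.
  Owner : ℕ → Set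
  Owner m = Fin n → Fin n → Maybe (Fin m)

  Owns : Owner m → Fin m → Fin n → Fin n → Set
  Owns owner k p q = owner p q ≡ just k

  set-owner : Owner m → Fin n → Fin n → Fin m → Owner m
  set-owner owner x y k p q = if does (p ≟ x) ∧ does (q ≟ y) then just k else owner p q

  -- Every push uses up an arc, so the number of arcs bounds the recursion.
  route : ∀ fuel {D} {pos : Fin m → Fin n} → size D ≤ fuel → Routable D pos →
          ∃ λ owner → (∀ {k p q} → Owns owner k p q → D p q ≡ true) × (∀ k → Star (Owns owner k) (pos k) r)
  route fuel {D} {pos} size≤ ok with all? (λ k → pos k ≟ r)
  ... | yes atSink = (λ _ _ → nothing) , (λ ()) , λ k → subst (Star _ (pos k)) (atSink k) ε
  ... | no ¬atSink with k , x≢r ← Fin.¬∀⟶∃¬ _ _ (λ k → pos k ≟ r) ¬atSink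
                   with push {D = D} {pos} k x≢r ok
  route zero    {D} {pos} size≤ _ | no _ | y , Dxy , _ = ⊥-elim (m+1+n≰m 0 (subst (_≤ 0) (trans (size-remove D Dxy) (+-comm _ 1)) size≤))
  route (suc fuel) {D} {pos} size≤ _ | no _ | y , Dxy , ok′
    with route fuel (≤-pred (subst (_≤ suc fuel) (trans (size-remove D Dxy) (+-comm _ 1)) size≤)) ok′
  ... | owner , owned , walks = owner⁺ , owned⁺ , walks⁺
    where
    owner⁺ = set-owner owner (pos k) y k
    owned⁺ : ∀ {j p q} → Owns owner⁺ j p q → D p q ≡ true
    owned⁺ {j} {p} {q} e with p ≟ pos k | q ≟ y
    ... | yes refl | yes refl = Dxy
    ... | yes _ | no _ = ∧-conicalˡ _ _ (owned e)
    ... | no _  | _    = ∧-conicalˡ _ _ (owned e)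
    -- The new arc was deleted before the recursive call and had no owner there, so overwriting its
    -- entry takes nothing from another walk.
    keep : ∀ {j p q} → Owns owner j p q → Owns owner⁺ j p q
    keep {j} {p} {q} e with p ≟ pos k | q ≟ y
    ... | yes refl | yes refl = case trans (sym (owned e)) (remove-self D (pos k) y) of λ ()
    ... | yes _ | no _ = e
    ... | no _  | _    = e
    first : Owns owner⁺ k (pos k) y
    first rewrite dec-true (pos k ≟ pos k) refl | dec-true (y ≟ y) refl = refl
    walks⁺ : ∀ j → Star (Owns owner⁺ j) (pos j) r
    walks⁺ j with j ≟ k
    ... | yes refl = first ◅ Star.map keep (subst (λ v → Star _ v r) (updateAt-updates k pos) (walks k))
    ... | no j≢k = Star.map keep (subst (λ v → Star _ v r) (updateAt-minimal j k pos j≢k) (walks j))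

-- Clique immersions from highly connected vertices

-- `Path` over an arbitrary relation: `R` will remember which pair of branch vertices each step was
-- allotted to.
record SimplePath {R : Fin n → Fin n → Set} (a b : Fin n) : Set where
  constructor simplePath
  field
    verts  : List (Fin n)
    starts : head verts ≡ just a
    ends   : last verts ≡ just b
    walk   : Linked R verts
    simple : Unique verts

module _ {R : Fin n → Fin n → Set} where

  suffix : ∀ {a b x} (p : SimplePath {R = R} x b) → a ∈ SimplePath.verts p → SimplePath {R = R} a b
  suffix (simplePath (_ ∷ vs) st en wa si) (here refl) = simplePath (_ ∷ vs) refl en wa si
  suffix (simplePath (_ ∷ v ∷ vs) st en (_ ∷ wa) (_ ∷ si)) (there a∈) =
    suffix (simplePath (v ∷ vs) refl en wa si) a∈

  -- Loop erasure: if the new first vertex already occurs on the path, the path is cut back to that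
  -- occurrence.
  shortcut : ∀ {a b} → Star R a b → SimplePath {R = R} a b
  shortcut {a} ε = simplePath (a ∷ []) refl refl [-] ([] ∷ [])
  shortcut {a} (r ◅ rs) with shortcut rs
  ... | p@(simplePath (v ∷ vs) refl en wa si) with Any.any? (a ≟_) (v ∷ vs)
  ... | yes a∈ = suffix p a∈
  ... | no a∉ = simplePath (a ∷ v ∷ vs) refl en (r ∷ wa) (¬Any⇒All¬ _ a∉ ∷ si)

does-sound : ∀ {P : Set} (P? : Dec P) → does P? ≡ true → P
does-sound (yes p) _ = p

adjacency : (G : Graph) → Digraph (Graph.n G)
adjacency G u v = does (Graph.adj? G u v)

adjacency-sound : (G : Graph) → ∀ {u v} → adjacency G u v ≡ true → Graph.Adj G u v
adjacency-sound G {u} {v} = does-sound (Graph.adj? G u v)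

adjacency-sym : (G : Graph) → Symmetric (adjacency G)
adjacency-sym G u v with Graph.adj? G u v | Graph.adj? G v u
... | yes _ | yes _ = refl
... | no _  | no _  = refl
... | yes a | no ¬a = ⊥-elim (¬a (Graph.sym G a))
... | no ¬a | yes a = ⊥-elim (¬a (Graph.sym G a))

consec : (G : Graph) {R : Fin (Graph.n G) → Fin (Graph.n G) → Set} → ∀ {vs u v} →
         Linked R vs → Consec G u v vs → R u v
consec G (r ∷ _)  here      = r
consec G (_ ∷ rs) (there c) = consec G rs c

-- The branch vertices other than the sink hold s tokens each, and token (a , b) starts at suc a.
-- The path joining suc a and suc b is made of the walks of (a , b) and (b , a),
-- the path joining the sink and suc a is the walk of (a , a).
data Serves {s : ℕ} : Fin s × Fin s → Fin (suc s) → Fin (suc s) → Set where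
  sink : ∀ {a} → Serves (a , a) zero (suc a)
  low  : ∀ {a b} → a Fin.< b → Serves (a , b) (suc a) (suc b)
  high : ∀ {a b} → a Fin.< b → Serves (b , a) (suc a) (suc b)

-- The order of the two components of a token decides the constructor. Hence paths of different
-- branch pairs share no token.
serves-functional : ∀ {s} {k : Fin s × Fin s} {i j i′ j′} →
                    Serves k i j → Serves k i′ j′ → i ≡ i′ × j ≡ j′
serves-functional sink     sink     = refl , refl
serves-functional sink     (low p)  = ⊥-elim (Fin.<-irrefl refl p)
serves-functional sink     (high p) = ⊥-elim (Fin.<-irrefl refl p)
serves-functional (low p)  sink     = ⊥-elim (Fin.<-irrefl refl p)
serves-functional (low p)  (low q)  = refl , refl
serves-functional (low p)  (high q) = ⊥-elim (Fin.<-asym p q)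
serves-functional (high p) sink     = ⊥-elim (Fin.<-irrefl refl p)
serves-functional (high p) (low q)  = ⊥-elim (Fin.<-asym p q)
serves-functional (high p) (high q) = refl , refl

load≤ : (pos : Fin m → Fin n) → ∀ W → load pos W ≤ m
load≤ {zero}  pos W = z≤n
load≤ {suc m} pos W = +-mono-≤ (𝟙≤1 (W (pos zero))) (load≤ (pos ∘ suc) W)
  where
  𝟙≤1 : ∀ b → 𝟙 b ≤ 1
  𝟙≤1 true  = ≤-refl
  𝟙≤1 false = z≤n

immersion : (G : Graph) → ∀ s (φ : Fin (suc s) → Fin (Graph.n G)) → (∀ i j → φ i ≡ φ j → i ≡ j) →
            (∀ i j → i ≢ j → ∀ W → W (φ i) ≢ W (φ j) → s * s ≤ δ (adjacency G) W) →
            ContainsKImmersion G (suc s)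
immersion G s φ φ-inj connected = record
  { φ        = φ
  ; φ-inj    = φ-inj
  ; path     = λ i j i<j → path (shortcut (walk i j i<j))
  ; disjoint = λ i j i′ j′ p p′ ne u v use use′ →
      ne (R-functional (path-uses (shortcut (walk i j p)) use) (path-uses (shortcut (walk i′ j′ p′)) use′))
  }
  where
  open Graph G using (Adj)
  N = Graph.n G
  r = φ zero
  open Routing r
  A = adjacency G

  pos : Fin (s * s) → Fin N
  pos k = φ (suc (proj₁ (remQuot s k)))

  routable : Routable A pos
  routable W Wr with any? (λ i → W (φ (suc i)) ≟ᵇ true)
  -- There are only `s * s` tokens in all, and `W` separates the branch vertex `φ (suc i)` from the
  -- sink.
  ... | yes (i , Wi) = ≤-trans (load≤ pos W)
    (connected (suc i) zero (λ ()) W λ e → case trans (sym Wi) (trans e Wr) of λ ())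
  ... | no ¬W = ≤-trans (≤-reflexive (sum-zero λ k → cong 𝟙 (¬-not {W (pos k)} λ e → ¬W (_ , e)))) z≤n

  oriented = orient (cartesianProduct (allFin N) (allFin N)) {A} {pos}
    (λ x → dec-false (Graph.adj? G x x) (Graph.irrefl G)) routable
  D = proj₁ oriented
  routes = route (size D) {D} {pos} ≤-refl (proj₁ (proj₂ (proj₂ oriented)))
  owner = proj₁ routes

  D-antisym : ∀ {u v} → D u v ≡ true → ¬ D v u ≡ true
  D-antisym {u} {v} uv vu = All.lookup (proj₂ (proj₂ (proj₂ oriented)))
    (∈-cartesianProduct⁺ (∈-allFin u) (∈-allFin v)) (uv , vu)

  owned : ∀ {k u v} → Owns owner k u v → D u v ≡ true
  owned = proj₁ (proj₂ routes)

  R : Fin (suc s) → Fin (suc s) → Fin N → Fin N → Set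
  R i j u v = ∃ λ k → Serves (remQuot s k) i j × (Owns owner k u v ⊎ Owns owner k v u)

  R-sym : ∀ {i j u v} → R i j u v → R i j v u
  R-sym (k , serves , owns) = k , serves , swap owns

  R⇒Adj : ∀ {i j u v} → R i j u v → Adj u v
  R⇒Adj (k , _ , inj₁ o) = adjacency-sound G (proj₁ (proj₂ oriented) (owned o))
  R⇒Adj (k , _ , inj₂ o) = Graph.sym G (adjacency-sound G (proj₁ (proj₂ oriented) (owned o)))

  R-functional : ∀ {i j i′ j′ u v} → R i j u v → R i′ j′ u v → i ≡ i′ × j ≡ j′
  R-functional (k , sv , inj₁ o) (k′ , sv′ , inj₁ o′) with refl ← trans (sym o) o′ = serves-functional sv sv′
  R-functional (k , sv , inj₂ o) (k′ , sv′ , inj₂ o′) with refl ← trans (sym o) o′ = serves-functional sv sv′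
  -- Opposite arcs of one edge cannot both be owned, as `D` is oriented.
  R-functional (k , sv , inj₁ o) (k′ , sv′ , inj₂ o′) = ⊥-elim (D-antisym (owned o) (owned o′))
  R-functional (k , sv , inj₂ o) (k′ , sv′ , inj₁ o′) = ⊥-elim (D-antisym (owned o) (owned o′))

  tokenWalk : ∀ a b {i j} → Serves (a , b) i j → Star (R i j) (φ (suc a)) r
  tokenWalk a b {i} {j} serves = subst (λ (a , _) → Star (R i j) (φ (suc a)) r) (remQuot-combine a b)
    (Star.map (λ o → combine a b , subst (λ k → Serves k i j) (sym (remQuot-combine a b)) serves , inj₁ o)
              (proj₂ (proj₂ routes) (combine a b)))

  walk : ∀ i j → i Fin.< j → Star (R i j) (φ i) (φ j)
  walk zero    (suc b) _         = Star.reverse R-sym (tokenWalk b b sink)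
  walk (suc a) (suc b) (s≤s a<b) = tokenWalk a b (low a<b) ◅◅ Star.reverse R-sym (tokenWalk b a (high a<b))

  path : ∀ {i j a b} → SimplePath {R = R i j} a b → Path G a b
  path (simplePath vs st en wa si) = record
    { verts = vs ; starts = st ; ends = en ; walk = Linked.map R⇒Adj wa ; simple = si }

  path-uses : ∀ {i j a b u v} (p : SimplePath {R = R i j} a b) → UsesEdge G (path p) u v → R i j u v
  path-uses p (inj₁ c) = consec G (SimplePath.walk p) c
  path-uses p (inj₂ c) = R-sym (consec G (SimplePath.walk p) c)

-- Laminar families of minimum cuts

infix 4 _⊆_

_⊆_ : Subset n → Subset n → Set
W ⊆ Z = ∀ x → W x ≡ true → Z x ≡ true

Disjoint : Subset n → Subset n → Set
Disjoint W Z = ∀ x → W x ≡ true → Z x ≡ false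

Laminar : Subset n → Subset n → Set
Laminar W Z = W ⊆ Z ⊎ Z ⊆ W ⊎ Disjoint W Z

contrapositive : ∀ {a b} → (a ≡ true → b ≡ true) → b ≡ false → a ≡ false
contrapositive h e = ¬-not λ t → case trans (sym (h t)) e of λ ()

avoid : ∀ {a b} → (a ≡ true → b ≡ false) → b ≡ true → a ≡ false
avoid h e = ¬-not λ t → case trans (sym (h t)) e of λ ()

∨-elim : ∀ a {b} → a ∨ b ≡ true → a ≡ true ⊎ b ≡ true
∨-elim true  _ = inj₁ refl
∨-elim false e = inj₂ e

∖-member : ∀ {a b} → a ≡ true → b ≡ false → a ∧ not b ≡ true
∖-member refl refl = refl

laminar-sym : {W Z : Subset n} → Laminar W Z → Laminar Z W
laminar-sym (inj₁ p)        = inj₂ (inj₁ p)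
laminar-sym (inj₂ (inj₁ p)) = inj₁ p
laminar-sym (inj₂ (inj₂ p)) = inj₂ (inj₂ λ x → avoid (p x))

laminar? : (W Z : Subset n) → Dec (Laminar W Z)
laminar? W Z = all? (λ x → (W x ≟ᵇ true) →-dec (Z x ≟ᵇ true)) ⊎-dec
               all? (λ x → (Z x ≟ᵇ true) →-dec (W x ≟ᵇ true)) ⊎-dec
               all? (λ x → (W x ≟ᵇ true) →-dec (Z x ≟ᵇ false))

laminar-members : ∀ {L : List (Subset n)} {X Z} → AllPairs Laminar L → X ∈ L → Z ∈ L → Laminar X Z
laminar-members _        (here refl) (here refl) = inj₁ λ _ → id
laminar-members (lX ∷ _) (here refl) (there Z∈)  = All.lookup lX Z∈
laminar-members (lZ ∷ _) (there X∈)  (here refl) = laminar-sym (All.lookup lZ X∈)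
laminar-members (_ ∷ l)  (there X∈)  (there Z∈)  = laminar-members l X∈ Z∈

-- `join` stands for the fourth corner, its complement: in a symmetric digraph both have the same
-- `δ`, and the union avoids the root.
data Corner (X Y : Subset n) : Subset n → Set where
  meet  : Corner X Y (X ∩ Y)
  left  : Corner X Y (X ∖ Y)
  right : Corner X Y (Y ∖ X)
  join  : Corner X Y (X ∪ Y)

corner-laminarˡ : {X Y W : Subset n} → Corner X Y W → Laminar W X
corner-laminarˡ meet  = inj₁ λ x → ∧-conicalˡ _ _
corner-laminarˡ left  = inj₁ λ x → ∧-conicalˡ _ _
corner-laminarˡ right = inj₂ (inj₂ λ x e → not-injective (∧-conicalʳ _ _ e))
corner-laminarˡ {Y = Y} join = inj₂ (inj₁ λ x → cong (_∨ Y x))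

corner-avoids : ∀ {r} {X Y W : Subset n} → X r ≡ false → Y r ≡ false → Corner X Y W → W r ≡ false
corner-avoids {r = r} {X} {Y} Xr Yr meet  = cong (_∧ Y r) Xr
corner-avoids {r = r} {X} {Y} Xr Yr left  = cong (_∧ not (Y r)) Xr
corner-avoids {r = r} {X} {Y} Xr Yr right = cong (_∧ not (X r)) Yr
corner-avoids Xr Yr join = cong₂ _∨_ Xr Yr

∖-laminar : {X Y Z : Subset n} → Laminar X Z → Laminar Y Z → ¬ Laminar X Y → Laminar (X ∖ Y) Z
∖-laminar (inj₁ XZ) _ _ = inj₁ λ x e → XZ x (∧-conicalˡ _ _ e)
∖-laminar (inj₂ (inj₂ XZ)) _ _ = inj₂ (inj₂ λ x e → XZ x (∧-conicalˡ _ _ e))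
∖-laminar (inj₂ (inj₁ ZX)) (inj₁ YZ) ¬XY = ⊥-elim (¬XY (inj₂ (inj₁ λ x e → ZX x (YZ x e))))
∖-laminar (inj₂ (inj₁ ZX)) (inj₂ (inj₁ ZY)) _ =
  inj₂ (inj₂ λ x e → contrapositive (ZY x) (not-injective (∧-conicalʳ _ _ e)))
∖-laminar (inj₂ (inj₁ ZX)) (inj₂ (inj₂ YZ)) _ = inj₂ (inj₁ λ x e → ∖-member (ZX x e) (avoid (YZ x) e))

-- A corner could cross `Z` only if `Z` lay between `X` and `Y`, or contained one and missed the
-- other; then `X` and `Y` would be laminar themselves.
corner-laminar : {X Y Z W : Subset n} → Laminar X Z → Laminar Y Z → ¬ Laminar X Y → Corner X Y W → Laminar W Z
corner-laminar XZ YZ ¬XY left  = ∖-laminar XZ YZ ¬XY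
corner-laminar XZ YZ ¬XY right = ∖-laminar YZ XZ (¬XY ∘ laminar-sym)
corner-laminar (inj₁ XZ) _ _ meet = inj₁ λ x e → XZ x (∧-conicalˡ _ _ e)
corner-laminar (inj₂ (inj₂ XZ)) _ _ meet = inj₂ (inj₂ λ x e → XZ x (∧-conicalˡ _ _ e))
corner-laminar (inj₂ (inj₁ ZX)) (inj₁ YZ) _ meet = inj₁ λ x e → YZ x (∧-conicalʳ _ _ e)
corner-laminar (inj₂ (inj₁ ZX)) (inj₂ (inj₁ ZY)) _ meet = inj₂ (inj₁ λ x e → cong₂ _∧_ (ZX x e) (ZY x e))
corner-laminar (inj₂ (inj₁ ZX)) (inj₂ (inj₂ YZ)) _ meet = inj₂ (inj₂ λ x e → YZ x (∧-conicalʳ _ _ e))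
corner-laminar {Y = Y} (inj₂ (inj₁ ZX)) _ _ join = inj₂ (inj₁ λ x e → cong (_∨ Y x) (ZX x e))
corner-laminar {X = X} (inj₁ _) (inj₂ (inj₁ ZY)) _ join =
  inj₂ (inj₁ λ x e → trans (cong (X x ∨_) (ZY x e)) (∨-zeroʳ (X x)))
corner-laminar {X = X} (inj₂ (inj₂ _)) (inj₂ (inj₁ ZY)) _ join =
  inj₂ (inj₁ λ x e → trans (cong (X x ∨_) (ZY x e)) (∨-zeroʳ (X x)))
corner-laminar {X = X} (inj₁ XZ) (inj₁ YZ) _ join = inj₁ λ x e → [ XZ x , YZ x ] (∨-elim (X x) e)
corner-laminar {X = X} (inj₂ (inj₂ XZ)) (inj₂ (inj₂ YZ)) _ join =
  inj₂ (inj₂ λ x e → [ XZ x , YZ x ] (∨-elim (X x) e))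
corner-laminar (inj₁ XZ) (inj₂ (inj₂ YZ)) ¬XY join = ⊥-elim (¬XY (inj₂ (inj₂ λ x e → avoid (YZ x) (XZ x e))))
corner-laminar (inj₂ (inj₂ XZ)) (inj₁ YZ) ¬XY join = ⊥-elim (¬XY (inj₂ (inj₂ λ x e → contrapositive (YZ x) (XZ x e))))

module Cuts {n} (D : Digraph n) (D-sym : Symmetric D) (r : Fin n) (k : ℕ) where

  Separates : Subset n → Fin n → Fin n → Set
  Separates W u v = W u ≢ W v

  MinCut : Subset n → Fin n → Fin n → Set
  MinCut W u v = ∀ Z → Separates Z u v → δ D W ≤ δ D Z

  Connected : Fin n → Fin n → Set
  Connected u v = ∀ Z → Separates Z u v → k ≤ δ D Z

  -- Each cut is represented by its side avoiding `r`. Minimality for some pair `a`, `b` is what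
  -- uncrossing against `X` relies on.
  record Good (X : Subset n) : Set where
    constructor good
    field
      rootless : X r ≡ false
      small    : δ D X < k
      {a b}    : Fin n
      splits   : Separates X a b
      minimal  : MinCut X a b

  Joined : List (Subset n) → Fin n → Fin n → Set
  Joined L u v = All (λ X → X u ≡ X v) L

  separates-resp : ∀ {u v W Z} → W ≗ Z → Separates W u v → Separates Z u v
  separates-resp {u} {v} h ne e = ne (trans (h u) (trans e (sym (h v))))

  minCutBelow : ∀ fuel u v Y → Separates Y u v → δ D Y ≤ fuel →
                ∃ λ X → Separates X u v × δ D X ≤ δ D Y × MinCut X u v
  minCutBelow fuel u v Y sep Y≤
    with anySet? {P = λ Z → Separates Z u v × δ D Z < δ D Y}
                 (λ Z → ¬? (Z u ≟ᵇ Z v) ×-dec (δ D Z <? δ D Y))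
                 (λ h (s , lt) → separates-resp h s , subst (_< δ D Y) (δ-cong D h) lt)
  ... | no ¬smaller = Y , sep , ≤-refl , λ Z s → ≮⇒≥ λ lt → ¬smaller (Z , s , lt)
  minCutBelow zero u v Y _ Y≤ | yes (Z , _ , lt) = ⊥-elim (n≮0 (<-≤-trans lt Y≤))
  minCutBelow (suc fuel) u v Y _ Y≤ | yes (Z , s , lt)
    with X , s′ , X≤ , min ← minCutBelow fuel u v Z s (≤-pred (<-≤-trans lt Y≤)) =
    X , s′ , ≤-trans X≤ (<⇒≤ lt) , min

  connected-or-cut : ∀ u v → Connected u v ⊎
    ∃ λ Y → Y r ≡ false × δ D Y < k × Separates Y u v × MinCut Y u v
  connected-or-cut u v
    with anySet? {P = λ Z → Separates Z u v × δ D Z < k}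
                 (λ Z → ¬? (Z u ≟ᵇ Z v) ×-dec (δ D Z <? k))
                 (λ h (s , lt) → separates-resp h s , subst (_< k) (δ-cong D h) lt)
  ... | no ¬cut = inj₁ λ Z s → ≮⇒≥ λ lt → ¬cut (Z , s , lt)
  ... | yes (Z , s , lt) with minCutBelow (δ D Z) u v Z s ≤-refl
  ... | Y , s′ , Y≤ , min with Y r in Yr
  ... | false = inj₂ (Y , Yr , ≤-<-trans Y≤ lt , s′ , min)
  -- The complement is an equally small cut of the same pair and avoids the root.
  ... | true  = inj₂ (∁ Y , cong not Yr , subst (_< k) (sym (δ-∁ D D-sym Y)) (≤-<-trans Y≤ lt) ,
                      (λ e → s′ (not-injective e)) , λ Z s → subst (_≤ δ D Z) (sym (δ-∁ D D-sym Y)) (min Z s))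

  exchange : ∀ {S T X Y} → δ D S + δ D T ≤ δ D X + δ D Y → δ D X ≤ δ D S → δ D T ≤ δ D Y
  exchange {S} {T} {X} {Y} sub X≤S = +-cancelˡ-≤ (δ D X) _ _ (≤-trans (+-monoˡ-≤ (δ D T) X≤S) sub)

  -- Whichever corner separates a from b has at least as many edges as X, so by sub- or
  -- posimodularity the opposite corner has at most as many as Y.
  uncross : ∀ {X a b} → X a ≡ true → X b ≡ false → MinCut X a b → ∀ Y {u v} → X u ≡ X v → Separates Y u v →
            ∃ λ W → Corner X Y W × δ D W ≤ δ D Y × Separates W u v
  uncross {X} {a} {b} Xa Xb min Y {u} {v} Xuv sep with X u in Xu | Y a in Ya | Y b in Yb
  -- If `u` and `v` lie in `X`, both corners inside `X` separate them, and the position of `b` tells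
  -- which opposite corner separates `a` from `b`. If they lie outside, the position of `a` tells.
  ... | true | _ | false = X ∩ Y , meet ,
    exchange {X ∪ Y} {X ∩ Y} {X} {Y} (subst (_≤ δ D X + δ D Y) (+-comm (δ D (X ∩ Y)) _) (δ-submodular D X Y))
      (min (X ∪ Y) λ e → case trans (sym (cong (_∨ Y a) Xa)) (trans e (cong₂ _∨_ Xb Yb)) of λ ()) ,
    λ e → sep (subst₂ (λ s t → s ∧ Y u ≡ t ∧ Y v) Xu (sym Xuv) e)
  ... | true | _ | true = X ∖ Y , left ,
    exchange {Y ∖ X} {X ∖ Y} {X} {Y} (subst (_≤ δ D X + δ D Y) (+-comm (δ D (X ∖ Y)) _) (δ-posimodular D D-sym X Y))
      (min (Y ∖ X) λ e → case trans (sym (∖-member Yb Xb)) (trans (sym e) (trans (cong (λ t → Y a ∧ not t) Xa) (∧-zeroʳ (Y a)))) of λ ()) ,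
    λ e → sep (not-injective (subst₂ (λ s t → s ∧ not (Y u) ≡ t ∧ not (Y v)) Xu (sym Xuv) e))
  ... | false | true | _ = X ∪ Y , join ,
    exchange {X ∩ Y} {X ∪ Y} {X} {Y} (δ-submodular D X Y)
      (min (X ∩ Y) λ e → case trans (sym (cong₂ _∧_ Xa Ya)) (trans e (cong (_∧ Y b) Xb)) of λ ()) ,
    λ e → sep (subst₂ (λ s t → s ∨ Y u ≡ t ∨ Y v) Xu (sym Xuv) e)
  ... | false | false | _ = Y ∖ X , right ,
    exchange {X ∖ Y} {Y ∖ X} {X} {Y} (δ-posimodular D D-sym X Y)
      (min (X ∖ Y) λ e → case trans (sym (∖-member Xa Ya)) (trans e (cong (_∧ not (Y b)) Xb)) of λ ()) ,
    λ e → sep (trans (sym (∧-identityʳ (Y u))) (trans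
      (subst₂ (λ s t → Y u ∧ not s ≡ Y v ∧ not t) Xu (sym Xuv) e) (∧-identityʳ (Y v))))

  uncross-good : ∀ {X} → Good X → ∀ Y {u v} → X u ≡ X v → Separates Y u v →
                 ∃ λ W → Corner X Y W × δ D W ≤ δ D Y × Separates W u v
  uncross-good {X} (good _ _ {a} {b} splits min) Y Xuv sep with X a in Xa | X b in Xb
  ... | true  | false = uncross Xa Xb min Y Xuv sep
  ... | false | true  = uncross Xb Xa (λ Z s → min Z (s ∘ sym)) Y Xuv sep
  ... | true  | true  = ⊥-elim (splits refl)
  ... | false | false = ⊥-elim (splits refl)

  -- Members are uncrossed one by one: `corner-laminar` preserves laminarity with those already
  -- treated, and `δ` never grows.
  uncross-family : ∀ {L} → All Good L → AllPairs Laminar L → ∀ Y {u v} → Joined L u v →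
    Y r ≡ false → Separates Y u v →
    ∃ λ W → W r ≡ false × δ D W ≤ δ D Y × Separates W u v × All (Laminar W) L
  uncross-family [] [] Y _ Yr sep = Y , Yr , ≤-refl , sep , []
  uncross-family {X ∷ L} (gX ∷ gL) (lX ∷ lL) Y (jX ∷ jL) Yr sep
    with W , Wr , W≤ , sepW , lamW ← uncross-family gL lL Y jL Yr sep
    with laminar? X W
  ... | yes XW = W , Wr , W≤ , sepW , laminar-sym XW ∷ lamW
  ... | no ¬XW with V , corner , V≤ , sepV ← uncross-good gX W jX sepW =
    V , corner-avoids (Good.rootless gX) Wr corner , ≤-trans V≤ W≤ , sepV ,
    corner-laminarˡ corner ∷ All.map (λ (XZ , WZ) → corner-laminar XZ WZ ¬XW corner) (All.zip (lX , lamW))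

  -- A discrete form of the Gomory–Hu tree.
  laminarFamily : (ps : List (Fin n × Fin n)) → ∃ λ L → All Good L × AllPairs Laminar L ×
                  All (λ (u , v) → Joined L u v → Connected u v) ps
  laminarFamily [] = [] , [] , [] , []
  laminarFamily ((u , v) ∷ ps) with laminarFamily ps
  ... | L , gL , lL , conn with connected-or-cut u v | All.all? (λ X → X u ≟ᵇ X v) L
  ... | inj₁ c | _ = L , gL , lL , (λ _ → c) ∷ conn
  ... | inj₂ _ | no ¬joined = L , gL , lL , (λ j → ⊥-elim (¬joined j)) ∷ conn
  ... | inj₂ (Y , Yr , Y< , sepY , minY) | yes joined
    with W , Wr , W≤ , sepW , lamW ← uncross-family gL lL Y joined Yr sepY =
    -- Since `δ D W ≤ δ D Y`, the set `W` is again a minimum cut for `u` and `v`. It makes the claim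
    -- for this pair vacuous and only strengthens the premise for the others.
    W ∷ L , good Wr (≤-<-trans W≤ Y<) sepW (λ Z s → ≤-trans W≤ (minY Z s)) ∷ gL , lamW ∷ lL ,
    (λ { (e ∷ _) → ⊥-elim (sepW e) }) ∷ All.map (λ { h (_ ∷ j) → h j }) conn

  -- Members containing `v` meet in `v`, so laminarity makes them a chain.
  leastMember : ∀ {L} → AllPairs Laminar L → All Good L → ∀ v →
    All (λ X → X v ≡ false) L ⊎
    ∃ λ X → δ D X < k × X v ≡ true × X ∈ L × All (λ Z → Z v ≡ true → X ⊆ Z) L
  leastMember [] [] v = inj₁ []
  leastMember {X ∷ L} (lX ∷ lL) (gX ∷ gL) v with X v in Xv | leastMember lL gL v
  ... | false | inj₁ none = inj₁ (Xv ∷ none)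
  ... | false | inj₂ (Z , Z< , Zv , Z∈ , least) =
    inj₂ (Z , Z< , Zv , there Z∈ , (λ e → case trans (sym Xv) e of λ ()) ∷ least)
  ... | true | inj₁ none =
    inj₂ (X , Good.small gX , Xv , here refl , (λ _ _ → id) ∷ All.map (λ e t → case trans (sym e) t of λ ()) none)
  ... | true | inj₂ (Z , Z< , Zv , Z∈ , least) with All.lookup lX Z∈
  ... | inj₁ XZ = inj₂ (X , Good.small gX , Xv , here refl ,
        (λ _ _ → id) ∷ All.map (λ h e x → h e x ∘ XZ x) least)
  ... | inj₂ (inj₁ ZX) = inj₂ (Z , Z< , Zv , there Z∈ , (λ _ → ZX) ∷ least)
  ... | inj₂ (inj₂ XZ) = case trans (sym Zv) (XZ v Xv) of λ ()

  module Order {L} (gL : All Good L) (lL : AllPairs Laminar L) where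

    -- The tree order: `w` is in the subtree of `v`. Vertices in exactly the same members form a
    -- bag, and those in no member form the root bag.
    Below : Fin n → Fin n → Set
    Below v w = All (λ X → X v ≡ true → X w ≡ true) L

    below? : ∀ v w → Dec (Below v w)
    below? v w = All.all? (λ X → (X v ≟ᵇ true) →-dec (X w ≟ᵇ true)) L

    below : Digraph n
    below v w = does (below? v w)

    below-sound : ∀ {v w} → below v w ≡ true → Below v w
    below-sound {v} {w} = does-sound (below? v w)

    below-complete : ∀ {v w} → Below v w → below v w ≡ true
    below-complete {v} {w} = dec-true (below? v w)

    below-refl : ∀ v → below v v ≡ true
    below-refl v = below-complete (All.universal (λ _ → id) L)

    below-trans : ∀ {u v w} → below u v ≡ true → below v w ≡ true → below u w ≡ true
    below-trans uv vw = below-complete (All.zipWith (λ (f , g) → g ∘ f) (below-sound uv , below-sound vw))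

    below-everything : ∀ {v} → All (λ X → X v ≡ false) L → ∀ w → below v w ≡ true
    below-everything none w = below-complete (All.map (λ e t → case trans (sym e) t of λ ()) none)

    below-least : ∀ {v w X} → All (λ Z → Z v ≡ true → X ⊆ Z) L → X w ≡ true → below v w ≡ true
    below-least {w = w} least Xw = below-complete (All.map (λ h Zv → h Zv w Xw) least)

    -- The least members around `u` and `v` both contain `w`, so they are nested; a vertex in no
    -- member is above everything.
    below-comparable : ∀ {u v w} → below u w ≡ true → below v w ≡ true → below u v ≡ true ⊎ below v u ≡ true
    below-comparable {u} {v} {w} uw vw with leastMember lL gL u | leastMember lL gL v
    ... | inj₁ none | _ = inj₁ (below-everything none v)
    ... | inj₂ _ | inj₁ none = inj₂ (below-everything none u)
    ... | inj₂ (X , _ , Xu , X∈ , leastX) | inj₂ (Z , _ , Zv , Z∈ , leastZ) with laminar-members lL X∈ Z∈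
    ... | inj₁ XZ = inj₂ (below-least leastZ (XZ u Xu))
    ... | inj₂ (inj₁ ZX) = inj₁ (below-least leastX (ZX v Zv))
    ... | inj₂ (inj₂ XZ) = case trans (sym (All.lookup (below-sound vw) Z∈ Zv)) (XZ w (All.lookup (below-sound uw) X∈ Xu)) of λ ()

    -- The subtree of `v` is the least member containing `v`, or else the whole vertex set, which no
    -- edge leaves; the latter case needs `0 < k`.
    below-cut : 0 < k → ∀ v → δ D (below v) < k
    below-cut k>0 v with leastMember lL gL v
    ... | inj₁ none = ≤-<-trans (≤-reflexive (sum-zero λ p → sum-zero λ q →
      cong 𝟙 (trans (cong (λ b → D p q ∧ below v p ∧ not b) (below-everything none q))
                    (trans (cong (D p q ∧_) (∧-zeroʳ (below v p))) (∧-zeroʳ (D p q)))))) k>0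
    ... | inj₂ (X , X<k , Xv , X∈ , least) = subst (_< k) (δ-cong D X≗) X<k
      where
      X≗ : X ≗ below v
      X≗ w = ⇔→≡ (mk⇔ (below-least least) λ vw → All.lookup (below-sound vw) X∈ Xv)

    mutual-joined : ∀ {u v w} → below v u ∧ below u v ≡ true → below v w ∧ below w v ≡ true → Joined L u w
    mutual-joined {u} {v} {w} vu vw = All.zipWith (λ (e , f) → trans (sym e) f) (joined vu , joined vw)
      where
      joined : ∀ {w} → below v w ∧ below w v ≡ true → Joined L v w
      joined {w} e = All.zipWith (λ (f , g) → ⇔→≡ (mk⇔ f g))
        (below-sound (∧-conicalˡ _ _ e) , below-sound (∧-conicalʳ (below v w) _ e))

-- Two-colouring along a tree order

opposite≢ : (c : Fin 2) → opposite c ≢ c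
opposite≢ zero       ()
opposite≢ (suc zero) ()

-- M v w says that v is an ancestor of w; the classes of mutual ancestors are the bags of the tree.
module TreeColouring {n} (D : Digraph n) (D-sym : Symmetric D) (M : Digraph n)
  (M-refl : ∀ v → M v v ≡ true)
  (M-trans : ∀ {u v w} → M u v ≡ true → M v w ≡ true → M u w ≡ true)
  (ancestors-comparable : ∀ {u v w} → M u w ≡ true → M v w ≡ true → M u v ≡ true ⊎ M v u ≡ true)
  where

  same : Digraph n
  same v w = M v w ∧ M w v

  depth : Fin n → ℕ
  depth y = sum λ z → 𝟙 (M z y)

  depth-< : ∀ {z y} → M z y ≡ true → M y z ≡ false → depth z < depth y
  depth-< {z} {y} zy yz = sum-mono-< (λ x → 𝟙-mono λ xz → M-trans xz zy) y
    (subst₂ (λ a b → 𝟙 a < 𝟙 b) (sym yz) (sym (M-refl y)) ≤-refl)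

  -- The edge may start anywhere in the bag of `y`, so that the colour depends on the bag alone.
  AdjacentAncestor : Fin n → Fin n → Set
  AdjacentAncestor y z = (∃ λ p → same y p ≡ true × D p z ≡ true) × M z y ≡ true × M y z ≡ false

  adjacentAncestor? : ∀ y z → Dec (AdjacentAncestor y z)
  adjacentAncestor? y z =
    any? (λ p → (same y p ≟ᵇ true) ×-dec (D p z ≟ᵇ true)) ×-dec (M z y ≟ᵇ true) ×-dec (M y z ≟ᵇ false)

  adjacentAncestor-resp : ∀ {y y′ z} → same y y′ ≡ true → AdjacentAncestor y z → AdjacentAncestor y′ z
  adjacentAncestor-resp {y} {y′} {z} yy′ ((p , yp , pz) , zy , yz) =
    (p , cong₂ _∧_ (M-trans y′⇐y (∧-conicalˡ _ _ yp)) (M-trans (∧-conicalʳ (M y p) _ yp) y⇒y′) , pz) ,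
    M-trans zy y⇒y′ , contrapositive (M-trans y⇒y′) yz
    where
    y⇒y′ = ∧-conicalˡ (M y y′) _ yy′
    y′⇐y = ∧-conicalʳ (M y y′) _ yy′

  Top : Fin n → Fin n → Set
  Top y z = AdjacentAncestor y z × (∀ z′ → AdjacentAncestor y z′ → M z z′ ≡ true)

  top? : ∀ y z → Dec (Top y z)
  top? y z = adjacentAncestor? y z ×-dec all? (λ z′ → adjacentAncestor? y z′ →-dec (M z z′ ≟ᵇ true))

  same-sym : ∀ {v w} → same v w ≡ true → same w v ≡ true
  same-sym {v} {w} e = cong₂ _∧_ (∧-conicalʳ (M v w) _ e) (∧-conicalˡ (M v w) _ e)

  top-resp : ∀ {y y′ z} → same y y′ ≡ true → Top y z → Top y′ z
  top-resp yy′ (a , t) = adjacentAncestor-resp yy′ a , λ z′ a′ → t z′ (adjacentAncestor-resp (same-sym yy′) a′)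

  top-unique : ∀ {y z z′} → Top y z → Top y z′ → same z z′ ≡ true
  top-unique (a , t) (a′ , t′) = cong₂ _∧_ (t _ a′) (t′ _ a)

  -- Ancestors of `y` are comparable, so one that `z` is not above lies strictly above `z` and has
  -- smaller depth.
  top-exists : ∀ fuel {y z} → depth z ≤ fuel → AdjacentAncestor y z → ∃ (Top y)
  top-exists fuel {y} {z} z≤ a@(_ , zy , _) with any? (λ z′ → adjacentAncestor? y z′ ×-dec (M z z′ ≟ᵇ false))
  ... | no none = z , a , λ z′ a′ → ¬-not λ e → none (z′ , a′ , e)
  ... | yes (z′ , a′@(_ , z′y , _) , zz′) with ancestors-comparable z′y zy
  ... | inj₂ e = case trans (sym e) zz′ of λ ()
  top-exists zero z≤ _ | yes (_ , _ , zz′) | inj₁ e = ⊥-elim (n≮0 (<-≤-trans (depth-< e zz′) z≤))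
  top-exists (suc fuel) z≤ _ | yes (z′ , a′ , zz′) | inj₁ e =
    top-exists fuel (≤-pred (<-≤-trans (depth-< e zz′) z≤)) a′

  colourUpTo : ℕ → Fin n → Fin 2
  -- A default that `colour` never reaches: its fuel exceeds the depth, which drops at each step up.
  colourUpTo zero    y = zero
  colourUpTo (suc f) y with any? (top? y)
  ... | yes (z , _) = opposite (colourUpTo f z)
  ... | no _        = zero

  -- Gives independence of the fuel and of the representative at once: the tops found for `y` and
  -- `y′` may differ but share a bag.
  colourUpTo-resp : ∀ f f′ {y y′} → same y y′ ≡ true → depth y < f → depth y′ < f′ →
                    colourUpTo f y ≡ colourUpTo f′ y′
  colourUpTo-resp (suc f) (suc f′) {y} {y′} yy′ y< y′< with any? (top? y) | any? (top? y′)
  ... | no _  | no _ = refl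
  ... | no ¬t | yes (z , t) = ⊥-elim (¬t (z , top-resp (same-sym yy′) t))
  ... | yes (z , t) | no ¬t = ⊥-elim (¬t (z , top-resp yy′ t))
  ... | yes (z , t@((_ , zy , yz) , _)) | yes (z′ , t′@((_ , zy′ , yz′) , _)) =
    cong opposite (colourUpTo-resp f f′ (top-unique (top-resp yy′ t) t′)
      (<-≤-trans (depth-< zy yz) (≤-pred y<)) (<-≤-trans (depth-< zy′ yz′) (≤-pred y′<)))

  colour : Fin n → Fin 2
  colour y = colourUpTo (suc (depth y)) y

  colour-resp : ∀ {y y′} → same y y′ ≡ true → colour y ≡ colour y′
  colour-resp yy′ = colourUpTo-resp _ _ yy′ ≤-refl ≤-refl

  colour-top : ∀ {y z} → Top y z → colour y ≡ opposite (colour z)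
  colour-top {y} {z} t with any? (top? y)
  ... | no ¬t = ⊥-elim (¬t (z , t))
  ... | yes (z′ , t′@((_ , z′y , yz′) , _)) =
    cong opposite (colourUpTo-resp _ _ (top-unique t′ t) (depth-< z′y yz′) ≤-refl)

  -- An edge leaving the subtree of `v` pays for a single bag: that of its outer end if it starts at
  -- `v`, otherwise that of its inner end.
  charged : Fin n → Fin n → Fin n → Fin n
  charged v p q = if does (p ≟ v) then q else p

  -- If w is below v but its bag has no edge out of the subtree of v, the topmost bag adjacent to it is that of v.
  monochromatic : ∀ v w → D v w ≡ true → colour w ≡ colour v →
    same v w ≡ true ⊎ ∃₂ λ p q → leaves D (M v) p q ≡ true × same (charged v p q) w ≡ true
  monochromatic v w vw cw with M v w in v≼w | M w v in w≼v
  ... | true | true = inj₁ refl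
  ... | false | _ = inj₂ (v , w , cong₂ _∧_ vw (∖-member (M-refl v) v≼w) , charge)
    where
    charge : same (charged v v w) w ≡ true
    charge rewrite dec-true (v ≟ v) refl = cong₂ _∧_ (M-refl w) (M-refl w)
  ... | true | false
    with z , t@(((p , wp , pz) , _) , _) ← top-exists _ ≤-refl
      ((w , cong₂ _∧_ (M-refl w) (M-refl w) , trans (D-sym w v) vw) , v≼w , w≼v)
    with M v z in v≼z
  -- As `v` is itself an adjacent ancestor of `w`, the top `z` is above `v`; being also below `v`,
  -- it shares its bag.
  ... | true = ⊥-elim (opposite≢ (colour v) (trans (cong opposite (colour-resp v∼z)) (trans (sym (colour-top t)) cw)))
    where
    v∼z : same v z ≡ true
    v∼z = cong₂ _∧_ v≼z (proj₂ t v ((w , cong₂ _∧_ (M-refl w) (M-refl w) , trans (D-sym w v) vw) , v≼w , w≼v))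
  ... | false = inj₂ (p , z , cong₂ _∧_ pz (∖-member (M-trans v≼w (∧-conicalˡ _ _ wp)) v≼z) , charge)
    where
    charge : same (charged v p z) w ≡ true
    charge with p ≟ v
    ... | no _ = same-sym wp
    ... | yes refl = case trans (sym (∧-conicalˡ _ _ wp)) w≼v of λ ()

  defect : ∀ {s k} → (∀ v → sum (λ w → 𝟙 (same v w)) ≤ s) → (∀ v → δ D (M v) < k) →
           ∀ v → sum (λ w → 𝟙 (D v w ∧ does (colour w ≟ colour v))) ≤ k * s
  defect {s} {k} bag≤ cut< v = begin
    sum (λ w → 𝟙 (D v w ∧ does (colour w ≟ colour v)))
      ≤⟨ sum-mono pointwise ⟩
    sum (λ w → 𝟙 (same v w) + Σ² λ p q → charge p q w)
      ≡⟨ ∑-distrib-+ (λ w → 𝟙 (same v w)) (λ w → Σ² λ p q → charge p q w) ⟩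
    sum (λ w → 𝟙 (same v w)) + sum (λ w → Σ² λ p q → charge p q w)
      ≡⟨ cong (sum (λ w → 𝟙 (same v w)) +_) (trans (∑-comm λ w p → sum λ q → charge p q w)
           (sum-cong-≗ λ p → ∑-comm λ w q → charge p q w)) ⟩
    sum (λ w → 𝟙 (same v w)) + Σ² (λ p q → sum (charge p q))
      ≤⟨ +-mono-≤ (bag≤ v) (Σ²-mono λ p q → charge≤ (leaves D (M v) p q) (charged v p q)) ⟩
    s + Σ² (λ p q → χ D (M v) p q * s)
      ≡⟨ cong (s +_) (trans (*-distribʳ-sum s (λ p → sum (χ D (M v) p)))
                            (sum-cong-≗ λ p → *-distribʳ-sum s (χ D (M v) p))) ⟨
    -- The bag of `v` supplies the extra `s`, which the strict bound on `δ` absorbs.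
    suc (δ D (M v)) * s
      ≤⟨ *-monoˡ-≤ s (cut< v) ⟩
    k * s ∎
    where
    open ≤-Reasoning
    charge : Fin n → Fin n → Fin n → ℕ
    charge p q w = 𝟙 (leaves D (M v) p q ∧ same (charged v p q) w)
    charge≤ : ∀ b u → sum (λ w → 𝟙 (b ∧ same u w)) ≤ 𝟙 b * s
    charge≤ true  u = ≤-trans (bag≤ u) (m≤m+n s 0)
    charge≤ false u = ≤-reflexive (sum-zero {n} λ _ → refl)
    pointwise : ∀ w → 𝟙 (D v w ∧ does (colour w ≟ colour v)) ≤ 𝟙 (same v w) + Σ² λ p q → charge p q w
    pointwise w with D v w in vw | colour w ≟ colour v
    ... | false | _ = z≤n
    ... | true | no _ = z≤n
    ... | true | yes cw with monochromatic v w vw cw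
    ... | inj₁ e = ≤-trans (≤-reflexive (cong 𝟙 (sym e))) (m≤m+n _ _)
    ... | inj₂ (p , q , lv , ch) = ≤-trans
      (≤-trans (≤-reflexive (cong 𝟙 (sym (cong₂ _∧_ lv ch)))) (≤-Σ² (λ p q → charge p q w) p q)) (m≤n+m _ _)

-- The defect bound for graphs without an immersed clique

empty-or-vertex : ∀ n → ¬ Fin n ⊎ Fin n
empty-or-vertex zero    = inj₁ λ ()
empty-or-vertex (suc n) = inj₂ zero

theorem31 : ∀ (t : ℕ) → 1 ≤ t → (G : Graph) →
    ¬ ContainsKImmersion G t →
    ColourableWithDefect G 2 ((t ∸ 1) ^ 3)
theorem31 (suc s) _ G ¬immersion with empty-or-vertex (Graph.n G)
-- Without vertices there is no root for the cuts to avoid.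
... | inj₁ empty = (λ _ → zero) , λ v → ⊥-elim (empty v)
... | inj₂ r with laminarFamily (cartesianProduct (allFin (Graph.n G)) (allFin (Graph.n G)))
  where open Cuts (adjacency G) (adjacency-sym G) r (s * s)
... | L , gL , lL , connected = colour , λ v → begin
  sameColourDegree G colour v
    ≡⟨ length-filter-tabulate (λ w → Graph.adj? G v w ×-dec (colour w ≟ colour v)) id ⟩
  sum (λ w → 𝟙 (A v w ∧ does (colour w ≟ colour v)))
    ≤⟨ defect bag≤ (below-cut (*-mono-≤ s>0 s>0)) v ⟩
  s * s * s
    ≡⟨ trans (*-assoc s s s) (cong (λ x → s * (s * x)) (sym (*-identityʳ s))) ⟩
  s ^ 3 ∎
  where
  open ≤-Reasoning
  A = adjacency G
  open Cuts A (adjacency-sym G) r (s * s)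
  open Order gL lL
  open TreeColouring A (adjacency-sym G) below below-refl below-trans below-comparable

  -- No member separates vertices of one bag, so by the choice of the family no cut below `s * s`
  -- does; `s + 1` of them would serve as branch vertices.
  bag≤ : ∀ v → sum (λ w → 𝟙 (same v w)) ≤ s
  bag≤ v = ≮⇒≥ λ s< → case count-injection (suc s) (same v) s< of λ where
    (φ , φ-inj , φ∈bag) → ¬immersion (immersion G s φ φ-inj λ i j _ →
      All.lookup connected (∈-cartesianProduct⁺ (∈-allFin (φ i)) (∈-allFin (φ j)))
        (mutual-joined (φ∈bag i) (φ∈bag j)))

  -- The bag of `r` contains `r`, so the bag bound cannot be zero.
  s>0 : 0 < s
  s>0 = ≤-trans (≤-trans (≤-reflexive (cong 𝟙 (sym (cong₂ _∧_ (below-refl r) (below-refl r)))))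
                         (≤-sum (λ w → 𝟙 (same r w)) r)) (bag≤ r)
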